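{- The sets $B$, $AB_0$, $\widehat{AB_0}$ and $\widehat{B^2}$ partition the nonnegative integers. The sets $G(n)$, for $n>0$, partition the set $AB$.
   Context: Let $\phi=\frac{1+\sqrt5}{2}$, and for integers $n\ge 0$ let $A(n)=\lfloor n\phi\rfloor$ and $B(n)=\lfloor n\phi^2\rfloor=\lfloor n\phi\rfloor+n$ (so $A(0)=B(0)=0$). Juxtaposition and powers denote composition: $AB(n)=A(B(n))$, $B^2(n)=B(B(n))$, and $B^k$ is the $k$-fold composition of $B$. Define the sets $B=\{B(n): n\ge 1\}=\{\lfloor n\phi\rfloor+n : n\ge 1\}$, $AB_0=\{AB(n): n\ge 0\}=\{2\lfloor n\phi\rfloor+n : n\ge 0\}$, $AB=\{AB(n): n\ge 1\}$, $\widehat{AB_0}=\{AB(n)+1 : n\ge 0\}=\{2\lfloor n\phi\rfloor+n+1 : n\ge 0\}$, $\widehat{B^2}=\{B^2(n)+1 : n\ge 1\}=\{3\lfloor n\phi\rfloor+2n+1 : n\ge 1\}$. The Fibonacci numbers are $F_{ -1}=1$, $F_0=0$, $F_1=F_2=1$, and $F_n=F_{n-1}+F_{n-2}$ for $n\ge 3$. For all integers $i\ge 0$ and $n\ge 0$ let $$G_i(n)=\lfloor i\phi\rfloor F_{2n+2}+iF_{2n+1}+F_{2n+3}-2=B^{n+1}(i)+F_{2n+3}-2,$$ and for all $n>0$ let $G(n)=\{G_i(n) : i>0\}$.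
   Formalization: The sets G(n) are taken as {G_i(n) : i ≥ 0} instead of i > 0, since with i > 0 the claim fails: 3 = AB(1) lies in AB, but G_i(n) ≥ 8 for all i, n > 0. -}

module Defs where

open import Data.Integer as ℤ using (ℤ; +_)
import Data.Integer.Properties as ℤ
open import Data.Nat as ℕ using (ℕ; zero; suc)
import Data.Nat.Properties as ℕ
open import Data.Product using (∃-syntax; _×_; _,_; proj₁)
open import Data.Rational as ℚ using (ℚ; 0ℚ; 1ℚ; ½; ∣_∣)
import Data.Rational.Properties as ℚ
import Data.Rational.Unnormalised as ℚᵘ
import Data.Rational.Unnormalised.Properties as ℚᵘ
open import Data.Rational.Solver using (module +-*-Solver)
open import Data.Sum using (inj₁; inj₂)
open import Function using (_∘_)
open import Level using (0ℓ)
open import Relation.Binary.PropositionalEquality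
open import Relation.Nullary using (yes; no; contradiction)
open import Relation.Unary using (Pred; Satisfiable; _⊥_; _≐_; ⋃)

-- φ and all its multiples lie in the real quadratic field ℚ(√5);
-- p +√5* q denotes the real number p + q√5.

infix 5 _+√5*_

record ℚ√5 : Set where
  constructor _+√5*_
  field
    rational   : ℚ
    irrational : ℚ

5ℚ : ℚ
5ℚ = + 5 ℚ./ 1

infixl 7 _*_
infixl 6 _-_

_*_ : ℚ√5 → ℚ√5 → ℚ√5
(p +√5* q) * (r +√5* s) =
  p ℚ.* r ℚ.+ 5ℚ ℚ.* (q ℚ.* s) +√5* p ℚ.* s ℚ.+ q ℚ.* r

_-_ : ℚ√5 → ℚ√5 → ℚ√5
(p +√5* q) - (r +√5* s) = p ℚ.- r +√5* q ℚ.- s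

fromℚ : ℚ → ℚ√5
fromℚ p = p +√5* 0ℚ

fromℤ : ℤ → ℚ√5
fromℤ k = fromℚ (k ℚ./ 1)

-- The order is the one induced from ℝ. Since t ↦ t∣t∣ is odd and strictly
-- increasing on ℝ, and maps q√5 to 5q∣q∣,
--   0 ≤ p + q√5  ⇔  - p ≤ q√5  ⇔  - p∣p∣ ≤ 5q∣q∣,
-- and likewise for <. So p∣p∣ + 5q∣q∣ has the same sign as p + q√5.

signed : ℚ√5 → ℚ
signed (p +√5* q) = p ℚ.* ∣ p ∣ ℚ.+ 5ℚ ℚ.* (q ℚ.* ∣ q ∣)

infix 4 _≤_ _<_

_≤_ _<_ : ℚ√5 → ℚ√5 → Set
x ≤ y = 0ℚ ℚ.≤ signed (y - x)
x < y = 0ℚ ℚ.< signed (y - x)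

IsFloor : ℚ√5 → ℤ → Set
IsFloor x k = fromℤ k ≤ x × x < fromℤ (k ℤ.+ + 1)

private
  signed-flip : ∀ x y → signed (x - y) ≡ ℚ.- signed (y - x)
  signed-flip (p +√5* q) (r +√5* s) = begin
    (p ℚ.- r) ℚ.* ∣ p ℚ.- r ∣ ℚ.+ 5ℚ ℚ.* ((q ℚ.- s) ℚ.* ∣ q ℚ.- s ∣)
      ≡⟨ cong₂ (λ a b → (p ℚ.- r) ℚ.* a ℚ.+ 5ℚ ℚ.* ((q ℚ.- s) ℚ.* b))
               (∣-∣-flip p r) (∣-∣-flip q s) ⟩
    (p ℚ.- r) ℚ.* ∣ r ℚ.- p ∣ ℚ.+ 5ℚ ℚ.* ((q ℚ.- s) ℚ.* ∣ s ℚ.- q ∣)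
      ≡⟨ solve 7 (λ p q r s a b c →
           (p :- r) :* a :+ c :* ((q :- s) :* b)
           := :- ((r :- p) :* a :+ c :* ((s :- q) :* b)))
           refl p q r s ∣ r ℚ.- p ∣ ∣ s ℚ.- q ∣ 5ℚ ⟩
    ℚ.- signed ((r +√5* s) - (p +√5* q)) ∎
    where
    open ≡-Reasoning
    open +-*-Solver
    ∣-∣-flip : ∀ a b → ∣ a ℚ.- b ∣ ≡ ∣ b ℚ.- a ∣
    ∣-∣-flip a b = trans
      (cong ∣_∣ (solve 2 (λ a b → a :- b := :- (b :- a)) refl a b))
      (ℚ.∣-p∣≡∣p∣ (b ℚ.- a))

  ≮⇒≥ : ∀ x y → 0ℚ ℚ.≮ signed (y - x) → y ≤ x
  ≮⇒≥ x y x≮y = subst (0ℚ ℚ.≤_) (sym (signed-flip x y))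
    (ℚ.neg-antimono-≤ (ℚ.≮⇒≥ x≮y))

  ≤⇒≯ : ∀ x y → x ≤ y → 0ℚ ℚ.≮ signed (x - y)
  ≤⇒≯ x y x≤y y<x = ℚ.<-irrefl refl
    (ℚ.<-≤-trans (subst (0ℚ ℚ.<_) (signed-flip x y) y<x) (ℚ.neg-antimono-≤ x≤y))

  search : ∀ x k fuel → fromℤ k ≤ x → x < fromℤ (k ℤ.+ + fuel) → ∃[ j ] IsFloor x j
  search x k zero k≤x x<k+0 =
    contradiction (subst (λ j → x < fromℤ j) (ℤ.+-identityʳ k) x<k+0)
                  (≤⇒≯ (fromℤ k) x k≤x)
  search x k (suc fuel) k≤x x<k+fuel
    with 0ℚ ℚ.<? signed (fromℤ (k ℤ.+ + 1) - x)
  ... | yes x<k+1 = k , k≤x , x<k+1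
  ... | no  x≮k+1 = search x (k ℤ.+ + 1) fuel (≮⇒≥ x (fromℤ (k ℤ.+ + 1)) x≮k+1)
          (subst (λ j → x < fromℤ j) (sym (ℤ.+-assoc k (+ 1) (+ fuel))) x<k+fuel)

  3ℚ : ℚ
  3ℚ = + 3 ℚ./ 1

  -∣p∣≤p : ∀ p → ℚ.- ∣ p ∣ ℚ.≤ p
  -∣p∣≤p p with ℚ.≤-total 0ℚ p
  ... | inj₁ 0≤p = ℚ.≤-trans (ℚ.neg-antimono-≤ (ℚ.0≤∣p∣ p)) 0≤p
  ... | inj₂ p≤0 = ℚ.≤-reflexive (begin
      ℚ.- ∣ p ∣       ≡⟨ cong ℚ.-_ (ℚ.∣-p∣≡∣p∣ p) ⟨
      ℚ.- ∣ ℚ.- p ∣   ≡⟨ cong ℚ.-_ (ℚ.0≤p⇒∣p∣≡p (ℚ.neg-antimono-≤ p≤0)) ⟩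
      ℚ.- (ℚ.- p)     ≡⟨ solve 1 (λ p → :- (:- p) := p) refl p ⟩
      p               ∎)
    where
    open ≡-Reasoning
    open +-*-Solver

  p≤∣p∣ : ∀ p → p ℚ.≤ ∣ p ∣
  p≤∣p∣ p = subst₂ ℚ._≤_ (solve 1 (λ p → :- (:- p) := p) refl p)
    (trans (solve 1 (λ p → :- (:- p) := p) refl ∣ ℚ.- p ∣) (ℚ.∣-p∣≡∣p∣ p))
    (ℚ.neg-antimono-≤ (-∣p∣≤p (ℚ.- p)))
    where open +-*-Solver

  0≤* : ∀ {p q} → 0ℚ ℚ.≤ p → 0ℚ ℚ.≤ q → 0ℚ ℚ.≤ p ℚ.* q
  0≤* {p} {q} 0≤p 0≤q = ℚ.nonNegative⁻¹ (p ℚ.* q)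
    {{ℚ.nonNeg*nonNeg⇒nonNeg p {{ℚ.nonNegative 0≤p}} q {{ℚ.nonNegative 0≤q}}}}

  signed-pos : ∀ p q → 3ℚ ℚ.* ∣ q ∣ ℚ.< p → 0ℚ ℚ.< signed (p +√5* q)
  signed-pos p q 3t<p = begin-strict
    0ℚ
      ≤⟨ ℚ.+-mono-≤ (0≤* {+ 4 ℚ./ 1} (ℚ.nonNegative⁻¹ _) (0≤* 0≤t 0≤t))
                    (0≤* {5ℚ} (ℚ.nonNegative⁻¹ _) (0≤* 0≤q+t 0≤t)) ⟩
    + 4 ℚ./ 1 ℚ.* (t ℚ.* t) ℚ.+ 5ℚ ℚ.* ((q ℚ.+ t) ℚ.* t)
      ≡⟨ solve 2 (λ q t →
           con (+ 4 ℚ./ 1) :* (t :* t) :+ con 5ℚ :* ((q :+ t) :* t)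
           := (con 3ℚ :* t) :* (con 3ℚ :* t) :+ con 5ℚ :* (q :* t)) refl q t ⟩
    (3ℚ ℚ.* t) ℚ.* (3ℚ ℚ.* t) ℚ.+ 5ℚ ℚ.* (q ℚ.* t)
      ≤⟨ ℚ.+-monoˡ-≤ (5ℚ ℚ.* (q ℚ.* t))
           (ℚ.*-monoˡ-≤-nonNeg (3ℚ ℚ.* t) {{ℚ.nonNegative 0≤3t}} (ℚ.<⇒≤ 3t<p)) ⟩
    (3ℚ ℚ.* t) ℚ.* p ℚ.+ 5ℚ ℚ.* (q ℚ.* t)
      <⟨ ℚ.+-monoˡ-< (5ℚ ℚ.* (q ℚ.* t))
           (ℚ.*-monoˡ-<-pos p {{ℚ.positive 0<p}} 3t<p) ⟩
    p ℚ.* p ℚ.+ 5ℚ ℚ.* (q ℚ.* t)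
      ≡⟨ cong (λ a → p ℚ.* a ℚ.+ 5ℚ ℚ.* (q ℚ.* t)) (ℚ.0≤p⇒∣p∣≡p (ℚ.<⇒≤ 0<p)) ⟨
    signed (p +√5* q) ∎
    where
    open ℚ.≤-Reasoning
    open +-*-Solver
    t : ℚ
    t = ∣ q ∣
    0≤t : 0ℚ ℚ.≤ t
    0≤t = ℚ.0≤∣p∣ q
    0≤q+t : 0ℚ ℚ.≤ q ℚ.+ t
    0≤q+t = subst (ℚ._≤ q ℚ.+ t) (ℚ.+-inverseˡ t) (ℚ.+-monoˡ-≤ t (-∣p∣≤p q))
    0≤3t : 0ℚ ℚ.≤ 3ℚ ℚ.* t
    0≤3t = 0≤* {3ℚ} (ℚ.nonNegative⁻¹ _) 0≤t
    0<p : 0ℚ ℚ.< p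
    0<p = ℚ.≤-<-trans 0≤3t 3t<p

  <suc∣↥∣ : ∀ p → p ℚ.< + suc ℤ.∣ ℚ.↥ p ∣ ℚ./ 1
  <suc∣↥∣ p@(ℚ.mkℚ n d c) = ℚ.toℚᵘ-cancel-<
    (ℚᵘ.<-respʳ-≃ (ℚᵘ.≃-sym (ℚ.toℚᵘ-fromℚᵘ (ℚᵘ.mkℚᵘ (+ suc ℤ.∣ n ∣) 0)))
      (ℚᵘ.*<* (begin-strict
        n ℤ.* + 1                 ≡⟨ ℤ.*-identityʳ n ⟩
        n                         ≤⟨ i≤∣i∣ n ⟩
        + ℤ.∣ n ∣                 <⟨ ℤ.+<+ (ℕ.n<1+n ℤ.∣ n ∣) ⟩
        + suc ℤ.∣ n ∣             ≤⟨ ℤ.+≤+ (ℕ.m≤m*n (suc ℤ.∣ n ∣) (suc d)) ⟩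
        + (suc ℤ.∣ n ∣ ℕ.* suc d) ≡⟨ ℤ.pos-* (suc ℤ.∣ n ∣) (suc d) ⟩
        + suc ℤ.∣ n ∣ ℤ.* + suc d ∎)))
    where
    open ℤ.≤-Reasoning
    i≤∣i∣ : ∀ i → i ℤ.≤ + ℤ.∣ i ∣
    i≤∣i∣ (+ _)      = ℤ.≤-refl
    i≤∣i∣ ℤ.-[1+ _ ] = ℤ.-≤+

opaque
  floor : ∀ x → ∃[ k ] IsFloor x k
  floor x@(p +√5* q) = search x ℤ.-[1+ m ] (suc m ℕ.+ suc m) (ℚ.<⇒≤ lower)
    (subst (λ k → x < fromℤ k) (sym shift) upper)
    where
    open +-*-Solver
    r : ℚ
    r = ∣ p ∣ ℚ.+ 3ℚ ℚ.* ∣ q ∣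
    m : ℕ
    m = ℤ.∣ ℚ.↥ r ∣
    N : ℚ
    N = + suc m ℚ./ 1
    bound : ∀ a → a ℚ.≤ ∣ p ∣ → 3ℚ ℚ.* ∣ q ∣ ℚ.< N ℚ.- a
    bound a a≤∣p∣ = subst (ℚ._< N ℚ.- a)
      (solve 2 (λ a b → (a :+ b) :- a := b) refl a (3ℚ ℚ.* ∣ q ∣))
      (ℚ.+-monoˡ-< (ℚ.- a)
        (ℚ.≤-<-trans (ℚ.+-monoˡ-≤ (3ℚ ℚ.* ∣ q ∣) a≤∣p∣) (<suc∣↥∣ r)))
    lower : fromℤ ℤ.-[1+ m ] < x
    lower = subst₂ (λ a b → 0ℚ ℚ.< signed (a +√5* b))
      (solve 2 (λ n p → n :- :- p := p :- :- n) refl N p)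
      (sym (ℚ.+-identityʳ q))
      (signed-pos (N ℚ.- ℚ.- p) q
        (bound (ℚ.- p) (subst (ℚ.- p ℚ.≤_) (ℚ.∣-p∣≡∣p∣ p) (p≤∣p∣ (ℚ.- p)))))
    upper : x < fromℤ (+ suc m)
    upper = signed-pos (N ℚ.- p) (0ℚ ℚ.- q)
      (subst (λ b → 3ℚ ℚ.* b ℚ.< N ℚ.- p)
        (trans (sym (ℚ.∣-p∣≡∣p∣ q)) (cong ∣_∣ (sym (ℚ.+-identityˡ (ℚ.- q)))))
        (bound p (p≤∣p∣ p)))
    shift : ℤ.-[1+ m ] ℤ.+ + (suc m ℕ.+ suc m) ≡ + suc m
    shift = trans (sym (ℤ.+-assoc ℤ.-[1+ m ] (+ suc m) (+ suc m)))
      (trans (cong (ℤ._+ + suc m) (ℤ.+-inverseˡ (+ suc m))) (ℤ.+-identityˡ (+ suc m)))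

⌊_⌋ : ℚ√5 → ℤ
⌊ x ⌋ = proj₁ (floor x)

φ : ℚ√5
φ = fromℚ ½ * (1ℚ +√5* 1ℚ)

-- Both floors are nonnegative, so the absolute value only turns them into ℕ.

A B : ℕ → ℕ
A n = ℤ.∣ ⌊ fromℤ (+ n) * φ ⌋ ∣
B n = ℤ.∣ ⌊ fromℤ (+ n) * (φ * φ) ⌋ ∣

F : ℕ → ℕ
F 0             = 0
F 1             = 1
F (suc (suc n)) = F (suc n) ℕ.+ F n

-- F (2n+3) ≥ 2, so the truncated subtraction is exact.

G : ℕ → ℕ → ℕ
G i n = A i ℕ.* F (2 ℕ.* n ℕ.+ 2) ℕ.+ i ℕ.* F (2 ℕ.* n ℕ.+ 1)
        ℕ.+ F (2 ℕ.* n ℕ.+ 3) ℕ.∸ 2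

-- ⟦ f ⟧≥ k = {f n : n ≥ k}

⟦_⟧≥_ : (ℕ → ℕ) → ℕ → Pred ℕ 0ℓ
(⟦ f ⟧≥ k) m = ∃[ n ] n ℕ.≥ k × f n ≡ m

-- ⁺ marks translation by 1, usually written with a hat.

𝐁 𝐀𝐁₀ 𝐀𝐁 𝐀𝐁₀⁺ 𝐁𝐁⁺ : Pred ℕ 0ℓ
𝐁    = ⟦ B ⟧≥ 1
𝐀𝐁₀  = ⟦ A ∘ B ⟧≥ 0
𝐀𝐁   = ⟦ A ∘ B ⟧≥ 1
𝐀𝐁₀⁺ = ⟦ suc ∘ A ∘ B ⟧≥ 0
𝐁𝐁⁺  = ⟦ suc ∘ B ∘ B ⟧≥ 1

-- Here i ranges over i ≥ 0, not i > 0: the values G 0 n = F (2n+3) ∸ 2 for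
-- n > 0, that is 3, 11, 32, …, are in 𝐀𝐁 and are not of the form G i n′ with
-- i, n′ > 0, so the sets {G i n : i > 0} do not cover 𝐀𝐁 (3 = A (B 1)).

𝐆 : ℕ → Pred ℕ 0ℓ
𝐆 n = ⟦ (λ i → G i n) ⟧≥ 0

record IsPartition {I : Set} (S : I → Pred ℕ 0ℓ) (T : Pred ℕ 0ℓ) : Set where
  field
    nonempty : ∀ i → Satisfiable (S i)
    disjoint : ∀ {i j} → i ≢ j → S i ⊥ S j
    union    : T ≐ ⋃ I S

{-# OPTIONS --safe #-}
module Submission where

-- Everything reduces to five identities for a = A(i), namely B(i) = a + i,
-- A(a + 1) = B(i) + 1, A(a) + 1 = B(i) (i ≥ 1), A(B(i)) = a + B(i) and
-- A(B(i) + 1) = A(B(i)) + 1, each of which is checked by means of the quadratic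
-- characterization i² + ia − a² ≥ 0 > i² + i(a + 1) − (a + 1)² of a = ⌊iφ⌋.
-- They determine how the letters A and B follow one another, which gives
-- Beatty's theorem by induction, and the first partition in the form
-- AA = (AB₀ + 1) ∪ (BB + 1). For the second one, G i (n + 1) = AB(K n i) where
-- K 0 i = A(i) + 1 and K (n + 1) i = B(K n i) + 1; by Beatty's theorem the
-- positive integers are partitioned by {A(i) + 1 : i ≥ 0} and {B(k) + 1 : k ≥ 1},
-- hence, by induction, by the ranges of K 0, K 1, ….

open import Data.Fin using (Fin)
open import Data.Fin.Patterns using (0F; 1F; 2F; 3F)
open import Data.Integer as ℤ using (ℤ; +_; -[1+_])
import Data.Integer.Properties as ℤ
import Data.Integer.Tactic.RingSolver as ℤSolver
open import Data.List using (_∷_; [])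
open import Data.Nat
open import Data.Nat.Induction using (Acc; acc; <-wellFounded)
open import Data.Nat.Properties
open import Data.Nat.Tactic.RingSolver using (solve; solve-∀)
open import Data.Product using (∃-syntax; _×_; _,_; proj₁; proj₂; swap)
open import Data.Rational as ℚ using (ℚ; 0ℚ; ½; ∣_∣)
import Data.Rational.Properties as ℚ
open import Data.Rational.Solver using (module +-*-Solver)
import Data.Rational.Unnormalised as ℚᵘ
import Data.Rational.Unnormalised.Properties as ℚᵘ
open import Data.Sum using (_⊎_; inj₁; inj₂; reduce)
open import Function using (_∘_)
open import Level using (0ℓ)
open import Relation.Binary.Definitions using (tri<; tri≈; tri>)
open import Relation.Binary.PropositionalEquality
open import Relation.Nullary using (contradiction)
open import Relation.Unary using (Pred; U; _⊥_)
open import Defs hiding (_≤_; _<_) renaming (_*_ to _*√_; _-_ to _-√_)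

open +-*-Solver using (con; _:+_; _:*_; _:-_; :-_; _:=_) renaming (solve to solveℚ)

-- The quadratic characterization of ⌊nφ⌋.

-- n φ < c, as φ is the positive root of φ² = φ + 1

Above : ℕ → ℕ → Set
Above n c = n * n + n * c < c * c

-- `lower` is a ≤ nφ and `upper` is nφ < a + 1. The weak inequality admits n = a = 0, where equality
-- holds.
record IsA (n a : ℕ) : Set where
  constructor isA
  field
    lower : a * a ≤ n * n + n * a
    upper : Above n (suc a)

open IsA

-- x ≤ y because y − x = (q − p) + s, with no subtraction in the equation to be checked.

transfer : ∀ {p q x y} s → p ≤ q → x + q + s ≡ y + p → x ≤ y
transfer {p} {q} {x} {y} s p≤q eq = +-cancelʳ-≤ p x y (begin
  x + p     ≤⟨ +-monoʳ-≤ x p≤q ⟩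
  x + q     ≤⟨ m≤m+n (x + q) s ⟩
  x + q + s ≡⟨ eq ⟩
  y + p     ∎)
  where open ≤-Reasoning

absurd-≤ : ∀ {p q} {W : Set} s → p ≤ q → p ≡ q + suc s → W
absurd-≤ {q = q} s p≤q refl = contradiction p≤q (m+1+n≰m q)

above⇒< : ∀ {n c} → Above n c → n < c
above⇒< {n} {c} above with ≤-<-connex c n
... | inj₂ n<c = n<c
... | inj₁ c≤n with m≤n⇒∃[o]m+o≡n c≤n
... | d , refl = 
  absurd-≤ (c * c + 3 * (c * d) + d * d) above (solve (c ∷ d ∷ []))

-- The hypothesis is n² < c(c - n), and the right side grows with c once c > n; `above⇒<` supplies
-- that, so c can be written as n + 1 + e.
above-mono : ∀ {n c c′} → c ≤ c′ → Above n c → Above n c′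
above-mono {n} {c} c≤c′ above with m≤n⇒∃[o]m+o≡n (above⇒< {n} {c} above) | m≤n⇒∃[o]m+o≡n c≤c′
... | e , refl | d , refl =
  transfer (n * d + 2 * d + 2 * (e * d) + d * d) above (solve (n ∷ e ∷ d ∷ []))

above-anti : ∀ {m n c} → n ≤ m → Above m c → Above n c
above-anti {m} {n} {c} n≤m = ≤-<-trans (+-mono-≤ (*-mono-≤ n≤m n≤m) (*-monoˡ-≤ c n≤m))

isA-mono : ∀ {m n a b} → IsA n a → IsA m b → n ≤ m → a ≤ b
isA-mono {m} {n} {a} {b} x y n≤m with ≤-<-connex a b
... | inj₁ a≤b = a≤b
... | inj₂ b<a = contradiction (lower x)
  (<⇒≱ (above-anti {c = a} n≤m (above-mono {m} b<a (upper y))))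

isA-unique : ∀ {n a b} → IsA n a → IsA n b → a ≡ b
isA-unique x y = ≤-antisym (isA-mono x y ≤-refl) (isA-mono y x ≤-refl)

-- φ < 2. This linear bound is the extra slack wherever a single quadratic inequality does not
-- suffice for `transfer`.
isA-bound : ∀ {n a} → IsA n a → a ≤ n + n
isA-bound {n} {a} x with ≤-<-connex a (n + n)
... | inj₁ a≤2n = a≤2n
... | inj₂ 2n<a with m≤n⇒∃[o]m+o≡n 2n<a
... | d , refl = 
  absurd-≤ (n * n + 3 * n + 3 * (n * d) + 2 * d + d * d) (lower x) (solve (n ∷ d ∷ []))

lower-suc : ∀ {n a} → IsA n a → suc a * suc a ≤ suc n * suc n + suc n * suc a
lower-suc {n} {a} x =
  transfer (suc n) (+-mono-≤ (lower x) (isA-bound x)) (solve (n ∷ a ∷ []))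

-- As φ > 1, a + 1 ≤ (n + 1)φ ≤ mφ by `lower-suc`, whereas b ≤ a would make a + 1 exceed mφ.
isA-strict : ∀ {m n a b} → IsA n a → IsA m b → n < m → a < b
isA-strict {m} {n} {a} {b} x y n<m with ≤-<-connex b a
... | inj₂ a<b = a<b
... | inj₁ b≤a = contradiction
  (above-anti {c = suc a} n<m (above-mono {m} (s≤s b≤a) (upper y)))
  (≤⇒≯ (lower-suc x))

-- The hypothesis says (i + d)/i = φ; then i/d = φ as well, with smaller terms.
descent : ∀ i d → (i + d) * (i + d) ≡ i * i + i * (i + d) → i * i ≡ d * d + d * i
descent i d eq = +-cancelʳ-≡ (i * i + i * d) (i * i) (d * d + d * i) (begin
  i * i + (i * i + i * d)         ≡⟨ solve (i ∷ d ∷ []) ⟩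
  i * i + i * (i + d)             ≡⟨ eq ⟨
  (i + d) * (i + d)               ≡⟨ solve (i ∷ d ∷ []) ⟩
  d * d + d * i + (i * i + i * d) ∎)
  where open ≡-Reasoning

-- Infinite descent on a. If a ≤ i, the equation forces i² ≤ 0. If i < a, the pair (i, a - i) is
-- again a solution, so a - i would vanish by induction, although it is positive.
irrational : ∀ {a i} → Acc _<_ a → a * a ≡ i * i + i * a → i ≡ 0
irrational {a} {i} (acc rec) eq with ≤-<-connex a i
... | inj₁ a≤i with m≤n⇒∃[o]m+o≡n a≤i
... | d , refl = reduce (m*n≡0⇒m≡0∨n≡0 (a + d) (n≤0⇒n≡0
  (transfer (d * a) (≤-reflexive (sym eq)) (solve (a ∷ d ∷ [])))))
irrational {a} {i} (acc rec) eq | inj₂ i<a with m≤n⇒∃[o]m+o≡n i<a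
... | d , refl with irrational {i} {suc d} (rec i<a)
  (descent i (suc d) (subst (λ a → a * a ≡ i * i + i * a) (sym (+-suc i d)) eq))
... | ()

isA-lower-< : ∀ {n a} → IsA (suc n) a → a * a < suc n * suc n + suc n * a
isA-lower-< {n} {a} x = ≤∧≢⇒< (lower x) λ eq →
  contradiction (irrational {a} {suc n} (<-wellFounded a) eq) 1+n≢0

-- Floors of φ-multiples at a, a + 1, a + i and a + i + 1.

isA-0 : IsA 0 0
isA-0 = isA z≤n (s≤s z≤n)

-- With δ = iφ - a in [0, 1), φ² = φ + 1 gives (a + 1)φ = (a + i + 1) + (1 - δ)/φ.
isA-A+1 : ∀ {i a} → IsA i a → IsA (suc a) (suc (a + i))
isA-A+1 {i} {a} x = isA
  (transfer 1 (upper x) (solve (i ∷ a ∷ [])))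
  (transfer i (+-mono-≤ (lower x) (isA-bound x)) (solve (i ∷ a ∷ [])))

-- For n = i + 1 and δ = nφ - a, aφ = a + n - δ/φ. Irrationality gives δ > 0, so the floor is a + n
-- - 1.
isA-A : ∀ {i a} → IsA (suc i) a → IsA a (a + i)
isA-A {i} {a} x = isA
  (transfer i (+-mono-≤ (upper x) (isA-bound x)) (solve (i ∷ a ∷ [])))
  (transfer 0 (isA-lower-< x) (solve (i ∷ a ∷ [])))

-- The fractional part is δ/φ², with δ = iφ - a.
isA-B : ∀ {i a} → IsA i a → IsA (a + i) (a + (a + i))
isA-B {i} {a} x = isA
  (transfer 0 (lower x) (solve (i ∷ a ∷ [])))
  (transfer (a + 2 * i) (upper x) (solve (i ∷ a ∷ [])))

-- The fractional part is δ/φ² + 1/φ, less than 1/φ² + 1/φ = 1.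
isA-B+1 : ∀ {i a} → IsA i a → IsA (suc (a + i)) (suc (a + (a + i)))
isA-B+1 {i} {a} x = isA
  (transfer (a + 2 * i + 1) (lower x) (solve (i ∷ a ∷ [])))
  (transfer 0 (upper x) (solve (i ∷ a ∷ [])))

-- From ℚ(√5) to the integers

ι : ℤ → ℚ
ι k = k ℚ./ 1

-- `ι k` does not compute for a variable k because it is normalised; the laws of `ι` are therefore
-- checked on unnormalised fractions.
toℚᵘ-ι : ∀ k → ℚ.toℚᵘ (ι k) ℚᵘ.≃ ℚᵘ.mkℚᵘ k 0
toℚᵘ-ι k = ℚ.toℚᵘ-fromℚᵘ (ℚᵘ.mkℚᵘ k 0)

ι-+ : ∀ i j → ι (i ℤ.+ j) ≡ ι i ℚ.+ ι j
ι-+ i j = ℚ.toℚᵘ-injective (begin-equality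
  ℚ.toℚᵘ (ι (i ℤ.+ j))                ≃⟨ toℚᵘ-ι (i ℤ.+ j) ⟩
  ℚᵘ.mkℚᵘ (i ℤ.+ j) 0                 ≡⟨ cong (λ k → ℚᵘ.mkℚᵘ k 0) (cong₂ ℤ._+_ (ℤ.*-identityʳ i) (ℤ.*-identityʳ j)) ⟨
  ℚᵘ.mkℚᵘ i 0 ℚᵘ.+ ℚᵘ.mkℚᵘ j 0        ≃⟨ ℚᵘ.+-cong (toℚᵘ-ι i) (toℚᵘ-ι j) ⟨
  ℚ.toℚᵘ (ι i) ℚᵘ.+ ℚ.toℚᵘ (ι j)      ≃⟨ ℚ.toℚᵘ-homo-+ (ι i) (ι j) ⟨
  ℚ.toℚᵘ (ι i ℚ.+ ι j)                ∎)
  where open ℚᵘ.≤-Reasoning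

ι-* : ∀ i j → ι (i ℤ.* j) ≡ ι i ℚ.* ι j
ι-* i j = ℚ.toℚᵘ-injective (begin-equality
  ℚ.toℚᵘ (ι (i ℤ.* j))                ≃⟨ toℚᵘ-ι (i ℤ.* j) ⟩
  ℚᵘ.mkℚᵘ i 0 ℚᵘ.* ℚᵘ.mkℚᵘ j 0        ≃⟨ ℚᵘ.*-cong (toℚᵘ-ι i) (toℚᵘ-ι j) ⟨
  ℚ.toℚᵘ (ι i) ℚᵘ.* ℚ.toℚᵘ (ι j)      ≃⟨ ℚ.toℚᵘ-homo-* (ι i) (ι j) ⟨
  ℚ.toℚᵘ (ι i ℚ.* ι j)                ∎)
  where open ℚᵘ.≤-Reasoning

ι-neg : ∀ i → ι (ℤ.- i) ≡ ℚ.- ι i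
ι-neg i = ℚ.toℚᵘ-injective (begin-equality
  ℚ.toℚᵘ (ι (ℤ.- i))                  ≃⟨ toℚᵘ-ι (ℤ.- i) ⟩
  ℚᵘ.- ℚᵘ.mkℚᵘ i 0                    ≃⟨ ℚᵘ.-‿cong (toℚᵘ-ι i) ⟨
  ℚᵘ.- ℚ.toℚᵘ (ι i)                   ≃⟨ ℚ.toℚᵘ-homo‿- (ι i) ⟨
  ℚ.toℚᵘ (ℚ.- ι i)                    ∎)
  where open ℚᵘ.≤-Reasoning

ι-∣∣ : ∀ i → ∣ ι i ∣ ≡ ι (+ ℤ.∣ i ∣)
ι-∣∣ i = ℚ.toℚᵘ-injective (begin-equality
  ℚ.toℚᵘ ∣ ι i ∣                      ≃⟨ ℚ.toℚᵘ-homo-∣-∣ (ι i) ⟩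
  ℚᵘ.∣ ℚ.toℚᵘ (ι i) ∣                 ≃⟨ ℚᵘ.∣-∣-cong (toℚᵘ-ι i) ⟩
  ℚᵘ.mkℚᵘ (+ ℤ.∣ i ∣) 0               ≃⟨ toℚᵘ-ι (+ ℤ.∣ i ∣) ⟨
  ℚ.toℚᵘ (ι (+ ℤ.∣ i ∣))              ∎)
  where open ℚᵘ.≤-Reasoning

ι-cancel-≤ : ∀ {i j} → ι i ℚ.≤ ι j → i ℤ.≤ j
ι-cancel-≤ {i} {j} ιi≤ιj
  with ℚᵘ.≤-respʳ-≃ (toℚᵘ-ι j) (ℚᵘ.≤-respˡ-≃ (toℚᵘ-ι i) (ℚ.toℚᵘ-mono-≤ ιi≤ιj))
... | ℚᵘ.*≤* i*1≤j*1 = subst₂ ℤ._≤_ (ℤ.*-identityʳ i) (ℤ.*-identityʳ j) i*1≤j*1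

ι-cancel-< : ∀ {i j} → ι i ℚ.< ι j → i ℤ.< j
ι-cancel-< {i} {j} ιi<ιj
  with ℚᵘ.<-respʳ-≃ (toℚᵘ-ι j) (ℚᵘ.<-respˡ-≃ (toℚᵘ-ι i) (ℚ.toℚᵘ-mono-< ιi<ιj))
... | ℚᵘ.*<* i*1<j*1 = subst₂ ℤ._<_ (ℤ.*-identityʳ i) (ℤ.*-identityʳ j) i*1<j*1

-- n φ − k = ((n − 2k) + n √5) / 2, so its sign is that of an integer.

¼ : ℚ
¼ = + 1 ℚ./ 4

signedℤ : ℤ → ℤ → ℤ
signedℤ z w = z ℤ.* + ℤ.∣ z ∣ ℤ.+ + 5 ℤ.* (w ℤ.* + ℤ.∣ w ∣)

halve : ℤ → ℤ → ℚ√5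
halve z w = ½ ℚ.* ι z +√5* ½ ℚ.* ι w

-- `signed` is homogeneous of degree 2, so halving divides it by 4. This turns the sign test into
-- one in ℤ.
signed-halve : ∀ z w → signed (halve z w) ≡ ¼ ℚ.* ι (signedℤ z w)
signed-halve z w = begin
  signed (halve z w)
    ≡⟨ cong₂ (λ a b → ½ ℚ.* ι z ℚ.* a ℚ.+ 5ℚ ℚ.* (½ ℚ.* ι w ℚ.* b)) (∣½∣ z) (∣½∣ w) ⟩
  ½ ℚ.* ι z ℚ.* (½ ℚ.* ∥z∥) ℚ.+ 5ℚ ℚ.* (½ ℚ.* ι w ℚ.* (½ ℚ.* ∥w∥))
    ≡⟨ solveℚ 4 (λ z a w b →
         con ½ :* z :* (con ½ :* a) :+ con 5ℚ :* (con ½ :* w :* (con ½ :* b))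
         := con ¼ :* (z :* a :+ con 5ℚ :* (w :* b))) refl (ι z) ∥z∥ (ι w) ∥w∥ ⟩
  ¼ ℚ.* (ι z ℚ.* ∥z∥ ℚ.+ 5ℚ ℚ.* (ι w ℚ.* ∥w∥))
    ≡⟨ cong (¼ ℚ.*_) (cong₂ (λ a b → a ℚ.+ 5ℚ ℚ.* b) (ι-* z (+ ℤ.∣ z ∣)) (ι-* w (+ ℤ.∣ w ∣))) ⟨
  ¼ ℚ.* (ι (z ℤ.* + ℤ.∣ z ∣) ℚ.+ 5ℚ ℚ.* ι (w ℤ.* + ℤ.∣ w ∣))
    ≡⟨ cong (λ a → ¼ ℚ.* (ι (z ℤ.* + ℤ.∣ z ∣) ℚ.+ a)) (ι-* (+ 5) (w ℤ.* + ℤ.∣ w ∣)) ⟨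
  ¼ ℚ.* (ι (z ℤ.* + ℤ.∣ z ∣) ℚ.+ ι (+ 5 ℤ.* (w ℤ.* + ℤ.∣ w ∣)))
    ≡⟨ cong (¼ ℚ.*_) (ι-+ (z ℤ.* + ℤ.∣ z ∣) (+ 5 ℤ.* (w ℤ.* + ℤ.∣ w ∣))) ⟨
  ¼ ℚ.* ι (signedℤ z w) ∎
  where
  open ≡-Reasoning
  ∥z∥ ∥w∥ : ℚ
  ∥z∥ = ι (+ ℤ.∣ z ∣)
  ∥w∥ = ι (+ ℤ.∣ w ∣)
  ∣½∣ : ∀ i → ∣ ½ ℚ.* ι i ∣ ≡ ½ ℚ.* ι (+ ℤ.∣ i ∣)
  ∣½∣ i = trans (ℚ.∣p*q∣≡∣p∣*∣q∣ ½ (ι i)) (cong (½ ℚ.*_) (ι-∣∣ i))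

halve-≥0 : ∀ z w → 0ℚ ℚ.≤ signed (halve z w) → + 0 ℤ.≤ signedℤ z w
halve-≥0 z w 0≤ = ι-cancel-≤ (ℚ.*-cancelˡ-≤-pos ¼ (subst (0ℚ ℚ.≤_) (signed-halve z w) 0≤))

halve->0 : ∀ z w → 0ℚ ℚ.< signed (halve z w) → + 0 ℤ.< signedℤ z w
halve->0 z w 0< = ι-cancel-< (ℚ.*-cancelˡ-<-nonNeg ¼ (subst (0ℚ ℚ.<_) (signed-halve z w) 0<))

nφ-k : ∀ n k → fromℤ n *√ φ -√ fromℤ k ≡ halve (n ℤ.- + 2 ℤ.* k) n
nφ-k n k = cong₂ _+√5*_
  (trans (solveℚ 2 (λ n k → n :* con ½ :+ con 5ℚ :* (con 0ℚ :* con ½) :- k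
                         := con ½ :* (n :- con (ι (+ 2)) :* k)) refl (ι n) (ι k))
    (cong (½ ℚ.*_) (sym (trans (ι-+ n (ℤ.- (+ 2 ℤ.* k))) (cong (ι n ℚ.+_)
      (trans (ι-neg (+ 2 ℤ.* k)) (cong ℚ.-_ (ι-* (+ 2) k))))))))
  (solveℚ 1 (λ n → n :* con ½ :+ con 0ℚ :* con ½ :- con 0ℚ := con ½ :* n) refl (ι n))

k-nφ : ∀ n k → fromℤ k -√ fromℤ n *√ φ ≡ halve (+ 2 ℤ.* k ℤ.- n) (ℤ.- n)
k-nφ n k = cong₂ _+√5*_
  (trans (solveℚ 2 (λ n k → k :- (n :* con ½ :+ con 5ℚ :* (con 0ℚ :* con ½))
                         := con ½ :* (con (ι (+ 2)) :* k :- n)) refl (ι n) (ι k))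
    (cong (½ ℚ.*_) (sym (trans (ι-+ (+ 2 ℤ.* k) (ℤ.- n)) (cong₂ ℚ._+_
      (ι-* (+ 2) k) (ι-neg n))))))
  (trans (solveℚ 1 (λ n → con 0ℚ :- (n :* con ½ :+ con 0ℚ :* con ½) := con ½ :* :- n) refl (ι n))
    (cong (½ ℚ.*_) (sym (ι-neg n))))

-- The irrational part of φ * φ is ½, like that of φ; its rational part is larger by 1.

nφ²-k : ∀ n k → fromℤ n *√ (φ *√ φ) -√ fromℤ k ≡ fromℤ n *√ φ -√ fromℤ (k ℤ.- n)
nφ²-k n k = cong₂ _+√5*_
  (trans (solveℚ 2 (λ n k → n :* con (ℚ√5.rational (φ *√ φ)) :+ con 5ℚ :* (con 0ℚ :* con ½) :- k
      := n :* con ½ :+ con 5ℚ :* (con 0ℚ :* con ½) :- (k :- n)) refl (ι n) (ι k))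
    (cong (λ a → ι n ℚ.* ½ ℚ.+ 5ℚ ℚ.* (0ℚ ℚ.* ½) ℚ.- a)
      (sym (trans (ι-+ k (ℤ.- n)) (cong (ι k ℚ.+_) (ι-neg n))))))
  (solveℚ 1 (λ n → n :* con ½ :+ con 0ℚ :* con (ℚ√5.rational (φ *√ φ)) :- con 0ℚ
      := n :* con ½ :+ con 0ℚ :* con ½ :- con 0ℚ) refl (ι n))

k-nφ² : ∀ n k → fromℤ (k ℤ.+ + 1) -√ fromℤ n *√ (φ *√ φ) ≡ fromℤ (k ℤ.- n ℤ.+ + 1) -√ fromℤ n *√ φ
k-nφ² n k = cong₂ _+√5*_
  (trans (solveℚ 2 (λ n k → k :- (n :* con (ℚ√5.rational (φ *√ φ)) :+ con 5ℚ :* (con 0ℚ :* con ½))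
      := (k :- n) :- (n :* con ½ :+ con 5ℚ :* (con 0ℚ :* con ½))) refl (ι n) (ι (k ℤ.+ + 1)))
    (cong (λ a → a ℚ.- (ι n ℚ.* ½ ℚ.+ 5ℚ ℚ.* (0ℚ ℚ.* ½)))
      (sym (trans (cong ι (shift k n)) (trans (ι-+ (k ℤ.+ + 1) (ℤ.- n)) (cong (ι (k ℤ.+ + 1) ℚ.+_) (ι-neg n)))))))
  (solveℚ 1 (λ n → con 0ℚ :- (n :* con ½ :+ con 0ℚ :* con (ℚ√5.rational (φ *√ φ)))
      := con 0ℚ :- (n :* con ½ :+ con 0ℚ :* con ½)) refl (ι n))
  where
  shift : ∀ k n → k ℤ.- n ℤ.+ + 1 ≡ k ℤ.+ + 1 ℤ.- n
  shift = ℤSolver.solve-∀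

-square : ∀ n → ℤ.- (+ n) ℤ.* + ℤ.∣ ℤ.- (+ n) ∣ ≡ ℤ.- (+ (n * n))
-square n = begin
  ℤ.- (+ n) ℤ.* + ℤ.∣ ℤ.- (+ n) ∣ ≡⟨ cong (λ m → ℤ.- (+ n) ℤ.* + m) (ℤ.∣-i∣≡∣i∣ (+ n)) ⟩
  ℤ.- (+ n) ℤ.* + n               ≡⟨ ℤ.neg-distribˡ-* (+ n) (+ n) ⟨
  ℤ.- (+ n ℤ.* + n)               ≡⟨ cong ℤ.-_ (ℤ.pos-* n n) ⟨
  ℤ.- (+ (n * n))                 ∎
  where open ≡-Reasoning

signedℤ-+- : ∀ m n → signedℤ (+ m) (ℤ.- (+ n)) ≡ + (m * m) ℤ.- + (5 * (n * n))
signedℤ-+- m n = cong₂ ℤ._+_ (sym (ℤ.pos-* m m)) (begin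
  + 5 ℤ.* (ℤ.- (+ n) ℤ.* + ℤ.∣ ℤ.- (+ n) ∣) ≡⟨ cong (+ 5 ℤ.*_) (-square n) ⟩
  + 5 ℤ.* ℤ.- (+ (n * n))                   ≡⟨ ℤ.neg-distribʳ-* (+ 5) (+ (n * n)) ⟨
  ℤ.- (+ 5 ℤ.* + (n * n))                   ≡⟨ cong ℤ.-_ (ℤ.pos-* 5 (n * n)) ⟨
  ℤ.- (+ (5 * (n * n)))                     ∎)
  where open ≡-Reasoning

signedℤ--+ : ∀ m n → signedℤ (ℤ.- (+ m)) (+ n) ≡ + (5 * (n * n)) ℤ.- + (m * m)
signedℤ--+ m n = trans
  (cong₂ ℤ._+_ (-square m) (trans (cong (+ 5 ℤ.*_) (sym (ℤ.pos-* n n))) (sym (ℤ.pos-* 5 (n * n)))))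
  (ℤ.+-comm (ℤ.- (+ (m * m))) (+ (5 * (n * n))))

0<i-j⇒j<i : ∀ {i j} → + 0 ℤ.< i ℤ.- j → j ℤ.< i
0<i-j⇒j<i {i} {j} 0<i-j = subst₂ ℤ._<_ (ℤ.+-identityˡ j) (i-j+j≡i i j) (ℤ.+-monoˡ-< j 0<i-j)
  where
  i-j+j≡i : ∀ i j → i ℤ.- j ℤ.+ j ≡ i
  i-j+j≡i = ℤSolver.solve-∀

x-y≡z⇒x≡z+y : ∀ {x y z} → x ℤ.- y ≡ z → x ≡ z ℤ.+ y
x-y≡z⇒x≡z+y {x} {y} refl = identity x y
  where
  identity : ∀ x y → x ≡ x ℤ.- y ℤ.+ y
  identity = ℤSolver.solve-∀

-- Completing the square: 4(c² - nc - n²) = (2c - n)² - 5n², with m = 2c - n.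
above-from-square : ∀ m n c → 2 * c ≡ m + n → 5 * (n * n) < m * m → Above n c
above-from-square m n c eq 5n²<m² = *-cancelˡ-< 4 (n * n + n * c) (c * c) (begin-strict
  4 * (n * n + n * c)                   ≡⟨ solve (n ∷ c ∷ []) ⟩
  4 * (n * n) + 2 * n * (2 * c)         ≡⟨ cong (λ d → 4 * (n * n) + 2 * n * d) eq ⟩
  4 * (n * n) + 2 * n * (m + n)         ≡⟨ solve (m ∷ n ∷ []) ⟩
  5 * (n * n) + (2 * (n * m) + n * n)   <⟨ +-monoˡ-< (2 * (n * m) + n * n) 5n²<m² ⟩
  m * m + (2 * (n * m) + n * n)         ≡⟨ solve (m ∷ n ∷ []) ⟩
  (m + n) * (m + n)                     ≡⟨ cong (λ d → d * d) eq ⟨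
  2 * c * (2 * c)                       ≡⟨ solve (c ∷ []) ⟩
  4 * (c * c)                           ∎)
  where open ≤-Reasoning

lower-from-square : ∀ m n a → 2 * a ≡ m + n → m * m ≤ 5 * (n * n) → a * a ≤ n * n + n * a
lower-from-square m n a eq m²≤5n² = *-cancelˡ-≤ 4 (begin
  4 * (a * a)                           ≡⟨ solve (a ∷ []) ⟩
  2 * a * (2 * a)                       ≡⟨ cong (λ d → d * d) eq ⟩
  (m + n) * (m + n)                     ≡⟨ solve (m ∷ n ∷ []) ⟩
  m * m + (2 * (n * m) + n * n)         ≤⟨ +-monoˡ-≤ (2 * (n * m) + n * n) m²≤5n² ⟩
  5 * (n * n) + (2 * (n * m) + n * n)   ≡⟨ solve (m ∷ n ∷ []) ⟩
  4 * (n * n) + 2 * n * (m + n)         ≡⟨ cong (λ d → 4 * (n * n) + 2 * n * d) eq ⟨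
  4 * (n * n) + 2 * n * (2 * a)         ≡⟨ solve (n ∷ a ∷ []) ⟩
  4 * (n * n + n * a)                   ∎)
  where open ≤-Reasoning

above-signed : ∀ n k → + 0 ℤ.< signedℤ (+ 2 ℤ.* k ℤ.- + n) (ℤ.- + n) →
  ∃[ c ] k ≡ + c × Above n c
above-signed n k 0<s with + 2 ℤ.* k ℤ.- + n in eq
-- If 2k - n < 0, both summands of `signedℤ` are at most 0.
... | -[1+ m ] = contradiction 0<s (ℤ.≤⇒≯ (ℤ.+-mono-≤ {y = + 0} ℤ.-≤+
  (ℤ.*-monoˡ-≤-nonNeg (+ 5) (subst (ℤ._≤ + 0) (sym (-square n)) (ℤ.neg-mono-≤ (ℤ.+≤+ z≤n))))))
... | + m with k | x-y≡z⇒x≡z+y {+ 2 ℤ.* k} eq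
... | + c | eq′ = c , refl , above-from-square m n c (ℤ.+-injective (trans (ℤ.pos-* 2 c) eq′))
  (ℤ.drop‿+<+ (0<i-j⇒j<i (subst (+ 0 ℤ.<_) (signedℤ-+- m n) 0<s)))
... | -[1+ _ ] | ()

lower-signed : ∀ n a → + 0 ℤ.≤ signedℤ (+ n ℤ.- + 2 ℤ.* + a) (+ n) → a * a ≤ n * n + n * a
lower-signed n a 0≤s with + n ℤ.- + 2 ℤ.* + a in eq
... | -[1+ m ] = lower-from-square (suc m) n a (ℤ.+-injective (begin
    + (2 * a)                      ≡⟨ ℤ.pos-* 2 a ⟩
    + 2 ℤ.* + a                    ≡⟨ flip (+ n) (+ 2 ℤ.* + a) ⟩
    ℤ.- (+ n ℤ.- + 2 ℤ.* + a) ℤ.+ + n ≡⟨ cong (λ z → ℤ.- z ℤ.+ + n) eq ⟩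
    + (suc m + n)                  ∎))
  (ℤ.drop‿+≤+ (ℤ.0≤i-j⇒j≤i (subst (+ 0 ℤ.≤_) (signedℤ--+ (suc m) n) 0≤s)))
  where
  open ≡-Reasoning
  flip : ∀ x y → y ≡ ℤ.- (x ℤ.- y) ℤ.+ x
  flip = ℤSolver.solve-∀
-- Here 2a ≤ n, so already a² ≤ na.
... | + m = ≤-trans (*-monoˡ-≤ a a≤n) (m≤n+m (n * a) (n * n))
  where
  n≡m+2a : n ≡ m + 2 * a
  n≡m+2a = ℤ.+-injective
    (trans (x-y≡z⇒x≡z+y {+ n} {+ 2 ℤ.* + a} eq) (cong (λ j → + m ℤ.+ j) (sym (ℤ.pos-* 2 a))))
  a≤n : a ≤ n
  a≤n = subst (a ≤_) (sym n≡m+2a) (≤-trans (m≤n*m a 2) (m≤n+m (2 * a) m))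

signedℤ⇒isA : ∀ n k → + 0 ℤ.≤ signedℤ (+ n ℤ.- + 2 ℤ.* k) (+ n) →
  + 0 ℤ.< signedℤ (+ 2 ℤ.* (k ℤ.+ + 1) ℤ.- + n) (ℤ.- + n) → ∃[ a ] k ≡ + a × IsA n a
signedℤ⇒isA n k lo hi with above-signed n (k ℤ.+ + 1) hi
... | zero , _ , above = contradiction (above⇒< {n} above) n≮0
-- k + 1 is read as k - (-1), so k = a. The case k + 1 = 0 fell to n < k + 1.
... | suc a , eq , above with x-y≡z⇒x≡z+y {k} {ℤ.-1ℤ} eq
... | refl = a , refl , isA (lower-signed n a lo) above

isFloor⇒isA : ∀ n k → IsFloor (fromℤ (+ n) *√ φ) k → ∃[ a ] k ≡ + a × IsA n a
isFloor⇒isA n k (lo , hi) = signedℤ⇒isA n k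
  (halve-≥0 (+ n ℤ.- + 2 ℤ.* k) (+ n)
    (subst (λ x → 0ℚ ℚ.≤ signed x) (nφ-k (+ n) k) lo))
  (halve->0 (+ 2 ℤ.* (k ℤ.+ + 1) ℤ.- + n) (ℤ.- + n)
    (subst (λ x → 0ℚ ℚ.< signed x) (k-nφ (+ n) (k ℤ.+ + 1)) hi))

isFloorφ²⇒isA : ∀ n k → IsFloor (fromℤ (+ n) *√ (φ *√ φ)) k → ∃[ a ] ℤ.∣ k ∣ ≡ a + n × IsA n a
isFloorφ²⇒isA n k (lo , hi) =
  let a , eq , x = isFloor⇒isA n (k ℤ.- + n)
        ( subst (λ x → 0ℚ ℚ.≤ signed x) (nφ²-k (+ n) k) lo
        , subst (λ x → 0ℚ ℚ.< signed x) (k-nφ² (+ n) k) hi )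
  in a , cong ℤ.∣_∣ (x-y≡z⇒x≡z+y {k} eq) , x

A-isA : ∀ n → IsA n (A n)
A-isA n =
  let a , eq , x = isFloor⇒isA n ⌊ fromℤ (+ n) *√ φ ⌋ (proj₂ (floor (fromℤ (+ n) *√ φ)))
  in subst (IsA n) (sym (cong ℤ.∣_∣ eq)) x

B≡A+n : ∀ n → B n ≡ A n + n
B≡A+n n =
  let a , eq , x = isFloorφ²⇒isA n ⌊ fromℤ (+ n) *√ (φ *√ φ) ⌋
        (proj₂ (floor (fromℤ (+ n) *√ (φ *√ φ))))
  in trans eq (cong (_+ n) (isA-unique x (A-isA n)))

open import Data.Vec using (lookup; _∷_; [])

-- A and B are variables here since the conversion checker would otherwise unfold
-- them down to arithmetic in ℚ.

module Wythoff
  (A B : ℕ → ℕ) (A-isA : ∀ n → IsA n (A n)) (B≡A+n : ∀ n → B n ≡ A n + n)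
  where

  -- Composition identities and monotonicity.

  A-unique : ∀ {n a} → IsA n a → A n ≡ a
  A-unique {n} = isA-unique (A-isA n)

  A∘A+1 : ∀ i → A (suc (A i)) ≡ suc (B i)
  A∘A+1 i = trans (A-unique (isA-A+1 (A-isA i))) (cong suc (sym (B≡A+n i)))

  1+A∘A : ∀ {i} → i ≥ 1 → suc (A (A i)) ≡ B i
  1+A∘A {suc i} _ = begin
    suc (A (A (suc i)))  ≡⟨ cong suc (A-unique (isA-A (A-isA (suc i)))) ⟩
    suc (A (suc i) + i)  ≡⟨ +-suc (A (suc i)) i ⟨
    A (suc i) + suc i    ≡⟨ B≡A+n (suc i) ⟨
    B (suc i)            ∎
    where open ≡-Reasoning

  A∘B : ∀ i → A (B i) ≡ A i + B i
  A∘B i = subst (λ b → A b ≡ A i + b) (sym (B≡A+n i)) (A-unique (isA-B (A-isA i)))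

  A∘B+1 : ∀ i → A (suc (B i)) ≡ suc (A (B i))
  A∘B+1 i = trans
    (subst (λ b → A (suc b) ≡ suc (A i + b)) (sym (B≡A+n i)) (A-unique (isA-B+1 (A-isA i))))
    (cong suc (sym (A∘B i)))

  1+B∘A : ∀ {i} → i ≥ 1 → suc (B (A i)) ≡ A (B i)
  1+B∘A {i} i≥1 = begin
    suc (B (A i))          ≡⟨ cong suc (B≡A+n (A i)) ⟩
    suc (A (A i) + A i)    ≡⟨ cong (_+ A i) (1+A∘A i≥1) ⟩
    B i + A i              ≡⟨ +-comm (B i) (A i) ⟩
    A i + B i              ≡⟨ A∘B i ⟨
    A (B i)                ∎
    where open ≡-Reasoning

  A-mono-< : ∀ {i j} → i < j → A i < A j
  A-mono-< {i} {j} = isA-strict (A-isA i) (A-isA j)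

  A-mono-≤ : ∀ {i j} → i ≤ j → A i ≤ A j
  A-mono-≤ {i} {j} = isA-mono (A-isA i) (A-isA j)

  B-mono-< : ∀ {i j} → i < j → B i < B j
  B-mono-< {i} {j} i<j =
    subst₂ _<_ (sym (B≡A+n i)) (sym (B≡A+n j)) (+-mono-< (A-mono-< i<j) i<j)

  mono⇒injective : ∀ {f : ℕ → ℕ} → (∀ {i j} → i < j → f i < f j) → ∀ {i j} → f i ≡ f j → i ≡ j
  mono⇒injective mono {i} {j} eq with <-cmp i j
  ... | tri< i<j _ _ = contradiction eq (<⇒≢ (mono i<j))
  ... | tri≈ _ i≡j _ = i≡j
  ... | tri> _ _ j<i = contradiction (sym eq) (<⇒≢ (mono j<i))

  A-injective : ∀ {i j} → A i ≡ A j → i ≡ j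
  A-injective = mono⇒injective {A} A-mono-<

  B-injective : ∀ {i j} → B i ≡ B j → i ≡ j
  B-injective = mono⇒injective {B} B-mono-<

  A-0 : A 0 ≡ 0
  A-0 = A-unique isA-0

  B-0 : B 0 ≡ 0
  B-0 = trans (B≡A+n 0) (trans (+-identityʳ (A 0)) A-0)

  n≤A : ∀ n → n ≤ A n
  n≤A n = s≤s⁻¹ (above⇒< {n} (IsA.upper (A-isA n)))

  n≤B : ∀ n → n ≤ B n
  n≤B n = subst (n ≤_) (sym (B≡A+n n)) (m≤n+m n (A n))

  -- Beatty's theorem.

  -- B k lies strictly between the values of A at the consecutive arguments A k and A k + 1.

  A≢B : ∀ {i k} → k ≥ 1 → A i ≢ B k
  A≢B {i} {k} k≥1 Ai≡Bk with ≤-<-connex i (A k)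
  ... | inj₁ i≤Ak = <⇒≢ (≤-<-trans (A-mono-≤ i≤Ak) (≤-reflexive (1+A∘A k≥1))) Ai≡Bk
  ... | inj₂ Ak<i = <⇒≢ (≤-trans (≤-reflexive (sym (A∘A+1 k))) (A-mono-≤ Ak<i)) (sym Ai≡Bk)

  -- The last letters of m determine its successor: B i is followed by A (A i + 1), A (A j) by B j,
  -- and A (B j) by A (B j + 1).
  beatty : ∀ {m} → Acc _<_ m → m ≥ 1 → (⟦ A ⟧≥ 1) m ⊎ (⟦ B ⟧≥ 1) m
  beatty {1} _ _ = inj₁ (1 , s≤s z≤n , trans (cong (A ∘ suc) (sym A-0)) (trans (A∘A+1 0) (cong suc B-0)))
  beatty {suc m@(suc _)} (acc rec) _ with beatty (rec ≤-refl) (s≤s z≤n)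
  ... | inj₂ (i , _ , Bi≡m) = inj₁ (suc (A i) , s≤s z≤n , trans (A∘A+1 i) (cong suc Bi≡m))
  -- The induction also applies to i, as i ≤ A i = m.
  ... | inj₁ (i , i≥1 , Ai≡m) with beatty (rec (s≤s (≤-trans (n≤A i) (≤-reflexive Ai≡m)))) i≥1
  ...   | inj₁ (j , j≥1 , refl) = inj₂ (j , j≥1 , trans (sym (1+A∘A j≥1)) (cong suc Ai≡m))
  ...   | inj₂ (j , _ , refl) = inj₁ (suc (B j) , s≤s z≤n , trans (A∘B+1 j) (cong suc Ai≡m))

  A⊎B : ∀ {m} → m ≥ 1 → (⟦ A ⟧≥ 1) m ⊎ (⟦ B ⟧≥ 1) m
  A⊎B = beatty (<-wellFounded _)

  -- The set AA as the union of AB₀ + 1 and BB + 1.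

  1+A∘B : ∀ i → suc (A (B i)) ≡ A (A (suc (A i)))
  1+A∘B i = sym (trans (cong A (A∘A+1 i)) (A∘B+1 i))

  1+B∘B : ∀ i → suc (B (B i)) ≡ A (A (suc (B i)))
  1+B∘B i = sym (trans (cong A (A∘B+1 i)) (A∘A+1 (B i)))

  -- Of the four two-letter forms of the predecessor m, AA k is excluded because its successor B k
  -- is no value of A, and BA k because its successor A (B k) would give A j = B k.
  A∘A-pred : ∀ {m j} → m ≥ 1 → A (A j) ≡ suc m →
    (⟦ suc ∘ A ∘ B ⟧≥ 0) (suc m) ⊎ (⟦ suc ∘ B ∘ B ⟧≥ 1) (suc m)
  A∘A-pred m≥1 AAj≡1+m with A⊎B m≥1
  ... | inj₁ (i , i≥1 , refl) with A⊎B i≥1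
  ...   | inj₁ (k , k≥1 , refl) = contradiction (trans AAj≡1+m (1+A∘A k≥1)) (A≢B k≥1)
  ...   | inj₂ (k , _ , refl) = inj₁ (k , z≤n , refl)
  A∘A-pred m≥1 AAj≡1+m | inj₂ (i , i≥1 , refl) with A⊎B i≥1
  ...   | inj₁ (k , k≥1 , refl) =
            contradiction (A-injective (trans AAj≡1+m (1+B∘A k≥1))) (A≢B k≥1)
  ...   | inj₂ (k , k≥1 , refl) = inj₂ (k , k≥1 , refl)

  A∘A⊆ : ∀ {m} j → m ≥ 1 → A (A j) ≡ m → (⟦ suc ∘ A ∘ B ⟧≥ 0) m ⊎ (⟦ suc ∘ B ∘ B ⟧≥ 1) m
  -- The predecessor is 0 = A (B 0), which accounts for the index 0 in AB₀ + 1.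
  A∘A⊆ {1}              _ _ _  = inj₁ (0 , z≤n , cong suc (trans (cong A B-0) A-0))
  A∘A⊆ {suc m@(suc _)} j _ eq = A∘A-pred (s≤s z≤n) eq

  -- The three other classes consist of values of A, through `1+A∘B` and `1+B∘B` for the translated
  -- ones.
  𝐁⊥A : ∀ {m i} → (⟦ B ⟧≥ 1) m → A i ≢ m
  𝐁⊥A (k , k≥1 , refl) = A≢B k≥1

  -- Extends `A≢B` to B 0 = 0, as AB₀ contains A (B 0); the argument of A is then a successor, which
  -- keeps its value positive.
  B≢A+1 : ∀ i j → B i ≢ A (suc j)
  B≢A+1 zero    j eq = <⇒≢ (≤-trans (s≤s z≤n) (n≤A (suc j))) (trans (sym B-0) eq)
  B≢A+1 (suc i) j eq = A≢B (s≤s z≤n) (sym eq)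

  -- The partition of the positive integers by the ranges of `K`.

  -- The k with A (B k) ∈ 𝐆′ (n + 1) are the values of K n.

  K : ℕ → ℕ → ℕ
  K zero    i = suc (A i)
  K (suc n) i = suc (B (K n i))

  K≥1 : ∀ n i → K n i ≥ 1
  K≥1 zero    i = s≤s z≤n
  K≥1 (suc n) i = s≤s z≤n

  -- After the successor is cancelled, level 0 gives a value of A and higher levels give a value of
  -- B at a positive argument; injectivity of B peels off one level at a time.
  K-disjoint : ∀ n n′ {i i′} → K n i ≡ K n′ i′ → n ≡ n′
  K-disjoint zero    zero     eq = refl
  K-disjoint zero    (suc n′) eq = contradiction (suc-injective eq) (A≢B (K≥1 n′ _))
  K-disjoint (suc n) zero     eq = contradiction (suc-injective (sym eq)) (A≢B (K≥1 n _))
  K-disjoint (suc n) (suc n′) eq = cong suc (K-disjoint n n′ (B-injective (suc-injective eq)))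

  K-cover : ∀ {k} → Acc _<_ k → k ≥ 1 → ∃[ n ] ∃[ i ] K n i ≡ k
  -- 1 = A 0 + 1 is reached only from i = 0, hence the range i ≥ 0.
  K-cover {1} _ _ = 0 , 0 , cong suc A-0
  K-cover {suc k@(suc _)} (acc rec) _ with A⊎B {k} (s≤s z≤n)
  ... | inj₁ (i , _ , Ai≡k) = 0 , i , cong suc Ai≡k
  ... | inj₂ (j , j≥1 , Bj≡k) with K-cover (rec (s≤s (≤-trans (n≤B j) (≤-reflexive Bj≡k)))) j≥1
  ...   | n , i , refl = suc n , i , cong suc Bj≡k

  -- The Fibonacci formula.

  -- All m are allowed, odd ones included, so that the Fibonacci recurrence applies one step at a
  -- time.
  H : ℕ → ℕ → ℕ
  H i m = A i * F (m + 2) + i * F (m + 1) + F (m + 3)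

  -- Unfolds to the same expression as `G` once the variable A is instantiated.
  G′ : ℕ → ℕ → ℕ
  G′ i n = H i (2 * n) ∸ 2

  𝐆′ : ℕ → Pred ℕ 0ℓ
  𝐆′ n = ⟦ (λ i → G′ i n) ⟧≥ 0

  H-rec : ∀ i m → H i (suc (suc m)) ≡ H i (suc m) + H i m
  H-rec i m = identity (A i) i
    (F (suc m + 2)) (F (m + 2)) (F (suc m + 1)) (F (m + 1)) (F (suc m + 3)) (F (m + 3))
    where
    identity : ∀ a i p q r s t u →
      a * (p + q) + i * (r + s) + (t + u) ≡ a * p + i * r + t + (a * q + i * s + u)
    identity = solve-∀

  A-K-suc : ∀ n i → A (K (suc n) i) ≡ suc (A (K n i) + (A (K n i) + K n i))
  A-K-suc n i = trans (A∘B+1 (K n i))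
    (cong suc (trans (A∘B (K n i)) (cong (λ b → A (K n i) + b) (B≡A+n (K n i)))))

  -- The left sides are B (K n i) + 1 and A (B (K n i)) + 2. Two consecutive values of `H` are
  -- carried because its recurrence has order 2: a step sends (x, y) to (y + x, y + x + y).
  A-K+K : ∀ n i →
    suc (A (K n i) + K n i) ≡ H i (1 + 2 * n) ×
    suc (suc (A (K n i) + (A (K n i) + K n i))) ≡ H i (2 + 2 * n)
  A-K+K zero i = base (trans (A∘A+1 i) (cong suc (B≡A+n i)))
    where
    -- The coefficients are F 3, F 2, F 4 here and F 4, F 3, F 5 in `identity₂`.
    identity₁ : ∀ a i → suc (suc (a + i) + suc a) ≡ a * 2 + i * 1 + 3
    identity₁ = solve-∀
    identity₂ : ∀ a i → suc (suc (suc (a + i) + (suc (a + i) + suc a))) ≡ a * 3 + i * 2 + 5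
    identity₂ = solve-∀
    base : ∀ {a a′ i} → a′ ≡ suc (a + i) →
      suc (a′ + suc a) ≡ a * 2 + i * 1 + 3 × suc (suc (a′ + (a′ + suc a))) ≡ a * 3 + i * 2 + 5
    base {a} {i = i} refl = identity₁ a i , identity₂ a i
  A-K+K (suc n) i =
    let h₁ , h₂ = A-K+K n i
        s₁ , s₂ = step {A (K n i)} h₁ h₂ (A-K-suc n i) (cong suc (B≡A+n (K n i)))
        r₁ = trans s₁ (sym (H-rec i (1 + 2 * n)))
        r₂ = trans s₂ (trans (cong (_+ H i (2 + 2 * n)) (sym (H-rec i (1 + 2 * n))))
                             (sym (H-rec i (2 + 2 * n))))
    in trans r₁ (cong (λ m → H i (1 + m)) (sym (*-suc 2 n))) ,
       trans r₂ (cong (λ m → H i (2 + m)) (sym (*-suc 2 n)))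
    where
    identity₁ : ∀ a k → suc (suc (a + (a + k)) + suc (a + k)) ≡ suc (suc (a + (a + k))) + suc (a + k)
    identity₁ = solve-∀
    identity₂ : ∀ a k → suc (suc (suc (a + (a + k)) + (suc (a + (a + k)) + suc (a + k))))
      ≡ suc (suc (a + (a + k))) + suc (a + k) + suc (suc (a + (a + k)))
    identity₂ = solve-∀
    step : ∀ {a k a′ k′ x y} → suc (a + k) ≡ x → suc (suc (a + (a + k))) ≡ y →
      a′ ≡ suc (a + (a + k)) → k′ ≡ suc (a + k) →
      suc (a′ + k′) ≡ y + x × suc (suc (a′ + (a′ + k′))) ≡ y + x + y
    step {a} {k} refl refl refl refl = identity₁ a k , identity₂ a k

  G′≡A∘B∘K : ∀ n i → G′ i (suc n) ≡ A (B (K n i))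
  G′≡A∘B∘K n i = begin
    H i (2 * suc n) ∸ 2                 ≡⟨ cong (λ m → H i m ∸ 2) (*-suc 2 n) ⟩
    H i (2 + 2 * n) ∸ 2                 ≡⟨ cong (_∸ 2) (proj₂ (A-K+K n i)) ⟨
    A (K n i) + (A (K n i) + K n i)     ≡⟨ cong (λ b → A (K n i) + b) (B≡A+n (K n i)) ⟨
    A (K n i) + B (K n i)               ≡⟨ A∘B (K n i) ⟨
    A (B (K n i))                       ∎
    where open ≡-Reasoning

  -- The first partition.

  classes : Fin 4 → ℕ → Set
  classes = lookup (⟦ B ⟧≥ 1 ∷ ⟦ A ∘ B ⟧≥ 0 ∷ ⟦ suc ∘ A ∘ B ⟧≥ 0 ∷ ⟦ suc ∘ B ∘ B ⟧≥ 1 ∷ [])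

  𝐁⊥𝐀𝐁₀ : classes 0F ⊥ classes 1F
  𝐁⊥𝐀𝐁₀ (m∈𝐁 , _ , _ , eq) = 𝐁⊥A m∈𝐁 eq

  𝐁⊥𝐀𝐁₀⁺ : classes 0F ⊥ classes 2F
  𝐁⊥𝐀𝐁₀⁺ (m∈𝐁 , i , _ , eq) = 𝐁⊥A m∈𝐁 (trans (sym (1+A∘B i)) eq)

  𝐁⊥𝐁𝐁⁺ : classes 0F ⊥ classes 3F
  𝐁⊥𝐁𝐁⁺ (m∈𝐁 , i , _ , eq) = 𝐁⊥A m∈𝐁 (trans (sym (1+B∘B i)) eq)

  -- Both sides are values of A; cancelling the outer A leaves B i against A (A j + 1).
  𝐀𝐁₀⊥𝐀𝐁₀⁺ : classes 1F ⊥ classes 2F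
  𝐀𝐁₀⊥𝐀𝐁₀⁺ ((i , _ , refl) , j , _ , eq) =
    B≢A+1 i (A j) (A-injective (trans (sym eq) (1+A∘B j)))

  𝐀𝐁₀⊥𝐁𝐁⁺ : classes 1F ⊥ classes 3F
  𝐀𝐁₀⊥𝐁𝐁⁺ ((i , _ , refl) , j , _ , eq) =
    B≢A+1 i (B j) (A-injective (trans (sym eq) (1+B∘B j)))

  𝐀𝐁₀⁺⊥𝐁𝐁⁺ : classes 2F ⊥ classes 3F
  𝐀𝐁₀⁺⊥𝐁𝐁⁺ ((i , _ , refl) , j , j≥1 , eq) =
    A≢B (≤-trans j≥1 (n≤B j)) (suc-injective (sym eq))

  -- Beatty's theorem, applied to m and then to its index, splits the positive integers into B, AB
  -- and AA.
  classes-cover-≥1 : ∀ {m} → m ≥ 1 → ∃[ i ] classes i m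
  classes-cover-≥1 m≥1 with A⊎B m≥1
  ... | inj₂ m∈B = 0F , m∈B
  ... | inj₁ (i , i≥1 , refl) with A⊎B i≥1
  ...   | inj₂ (j , _ , refl) = 1F , j , z≤n , refl
  ...   | inj₁ (j , _ , refl) with A∘A⊆ j m≥1 refl
  ...     | inj₁ m∈AB₀+1 = 2F , m∈AB₀+1
  ...     | inj₂ m∈BB+1  = 3F , m∈BB+1

  classes-cover : ∀ m → ∃[ i ] classes i m
  classes-cover zero    = 1F , 0 , z≤n , trans (cong A B-0) A-0
  classes-cover (suc _) = classes-cover-≥1 (s≤s z≤n)

  classes-disjoint : ∀ i j → i ≢ j → classes i ⊥ classes j
  classes-disjoint 0F 0F i≢j = contradiction refl i≢j
  classes-disjoint 1F 1F i≢j = contradiction refl i≢j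
  classes-disjoint 2F 2F i≢j = contradiction refl i≢j
  classes-disjoint 3F 3F i≢j = contradiction refl i≢j
  classes-disjoint 0F 1F _ = 𝐁⊥𝐀𝐁₀
  classes-disjoint 0F 2F _ = 𝐁⊥𝐀𝐁₀⁺
  classes-disjoint 0F 3F _ = 𝐁⊥𝐁𝐁⁺
  classes-disjoint 1F 2F _ = 𝐀𝐁₀⊥𝐀𝐁₀⁺
  classes-disjoint 1F 3F _ = 𝐀𝐁₀⊥𝐁𝐁⁺
  classes-disjoint 2F 3F _ = 𝐀𝐁₀⁺⊥𝐁𝐁⁺
  classes-disjoint 1F 0F _ = 𝐁⊥𝐀𝐁₀ ∘ swap
  classes-disjoint 2F 0F _ = 𝐁⊥𝐀𝐁₀⁺ ∘ swap
  classes-disjoint 3F 0F _ = 𝐁⊥𝐁𝐁⁺ ∘ swap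
  classes-disjoint 2F 1F _ = 𝐀𝐁₀⊥𝐀𝐁₀⁺ ∘ swap
  classes-disjoint 3F 1F _ = 𝐀𝐁₀⊥𝐁𝐁⁺ ∘ swap
  classes-disjoint 3F 2F _ = 𝐀𝐁₀⁺⊥𝐁𝐁⁺ ∘ swap

  classes-partition : IsPartition classes U
  classes-partition = record
    { nonempty = λ
      { 0F → _ , 1 , ≤-refl , refl
      ; 1F → _ , 0 , ≤-refl , refl
      ; 2F → _ , 0 , ≤-refl , refl
      ; 3F → _ , 1 , ≤-refl , refl
      }
    ; disjoint = λ {i} {j} → classes-disjoint i j
    ; union = (λ {m} _ → classes-cover m) , _
    }

  -- The second partition.

  𝐆-disjoint : ∀ n n′ {m} → 𝐆′ (suc n) m → 𝐆′ (suc n′) m → n ≡ n′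
  𝐆-disjoint n n′ (i , _ , refl) (i′ , _ , eq) = K-disjoint n n′ (B-injective (A-injective
    (trans (sym (G′≡A∘B∘K n i)) (trans (sym eq) (G′≡A∘B∘K n′ i′)))))

  𝐆-partition : IsPartition (λ ((n , _) : ∃[ n ] n > 0) → 𝐆′ n) (⟦ A ∘ B ⟧≥ 1)
  𝐆-partition = record
    { nonempty = λ _ → _ , 0 , z≤n , refl
    ; disjoint = λ
      -- Matching the positivity proofs makes them identical, so equal numbers give equal indices.
      { {suc n , s≤s z≤n} {suc n′ , s≤s z≤n} n≢n′ (x , y) →
        contradiction (cong (λ n → suc n , s≤s z≤n) (𝐆-disjoint n n′ x y)) n≢n′ }
    ; union = 𝐀𝐁⊆⋃𝐆 , λ { ((suc n , _) , i , _ , refl) → K n i , K≥1 n i , sym (G′≡A∘B∘K n i) }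
    }
    where
    𝐀𝐁⊆⋃𝐆 : ∀ {m} → (⟦ A ∘ B ⟧≥ 1) m → ∃[ n ] 𝐆′ (proj₁ {B = _> 0} n) m
    𝐀𝐁⊆⋃𝐆 (k , k≥1 , refl) with K-cover (<-wellFounded k) k≥1
    ... | n , i , refl = (suc n , s≤s z≤n) , i , z≤n , G′≡A∘B∘K n i

lemma2p1 :
    IsPartition (lookup (𝐁 ∷ 𝐀𝐁₀ ∷ 𝐀𝐁₀⁺ ∷ 𝐁𝐁⁺ ∷ [])) U
    × IsPartition (λ ((n , _) : ∃[ n ] n > 0) → 𝐆 n) 𝐀𝐁
lemma2p1 = classes-partition , 𝐆-partition
  where open Wythoff A B A-isA B≡A+n
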